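{- Let $\mathcal{A}$ be a finite alphabet, let $\mathcal{S}\subseteq\mathcal{A}^{\mathbb{Z}^2}$, and let $\mathcal{P}=\{P_1,\dots,P_n\}$ be the list (up to translation) of the $2\times2$ patterns that appear in the elements of $\mathcal{S}$. Then a $\mathcal{P}$-domino-complete two-dimensional substitution $\sigma$ on $\mathcal{A}$ is consistent on $\mathrm{patt}(\mathcal{S})$ if and only if it is consistent on the patterns $P_1,\dots,P_n$.
   Context: **Cells and patterns.** Let $\mathcal{A}$ be a finite set of symbols (the alphabet). A two-dimensional cell is a pair $c=[v,t]$ with $v\in\mathbb{Z}^2$ (the vector of $c$) and $t\in\mathcal{A}$ (the type of $c$). A two-dimensional pattern is a finite set of cells with pairwise distinct vectors. Patterns are translated by elements of $\mathbb{Z}^2$ by translating the vectors of their cells. A $2\times2$ pattern is a pattern whose set of vectors is a translate of $\{0,1\}^2$. A domino is a pattern consisting of two cells with vectors $v,v'$ such that $v'-v\in\{(\pm1,0),(0,\pm1)\}$. A pattern $P$ appears in $x\in\mathcal{A}^{\mathbb{Z}^2}$ if (up to translation) $x$ extends $P$, i.e. $x_v=t$ for every $[v,t]\in P$. For $\mathcal{S}\subseteq\mathcal{A}^{\mathbb{Z}^2}$, $\mathrm{patt}(\mathcal{S})$ is the set of patterns that appear in the elements of $\mathcal{S}$ (i.e. the patterns that can be extended to an element of $\mathcal{S}$). **Substitutions.** A two-dimensional substitution $\sigma$ on $\mathcal{A}$ consists of a base rule, i.e. a map $\sigma_{\mathrm{base}}$ from $\mathcal{A}$ to the set of patterns, and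 a finite set of concatenation rules $(t,t',u)\mapsto v$ with $t,t'\in\mathcal{A}$, $u,v\in\mathbb{Z}^2$, $u\neq 0$. All substitutions are assumed deterministic: if a rule has left-hand side $(t,t',u)$, then no other rule has left-hand side $(t,t',u)$ or $(t',t,-u)$. The set of starting patterns of $\sigma$ is $\mathcal{C}_\sigma=\{\{[0,t],[u,t']\} : (t,t',u)\mapsto v \text{ is a rule of } \sigma \text{ for some } v\}$. For cells $c=[u,t]$, $c'=[u',t']$, set $\sigma_{\mathrm{rule}}(c,c')=v$ if $(t,t',u'-u)\mapsto v$ is a rule of $\sigma$, $\sigma_{\mathrm{rule}}(c,c')=-v$ if $(t',t,u-u')\mapsto v$ is a rule of $\sigma$, and leave it undefined otherwise. If $\mathcal{P}$ is a set of patterns, $\sigma$ is $\mathcal{P}$-domino-complete if $\mathcal{C}_\sigma$ is equal, up to translation, to the set of dominoes that appear in the patterns of $\mathcal{P}$. **Paths.** A $\mathcal{C}_\sigma$-path from $c_1$ to $c_n$ is a finite sequence of cells $\gamma=(c_1,\dots,c_n)$ such that $\{c_i,c_{i+1}\}$ is a translate of an element of $\mathcal{C}_\sigma$ for all $1\le i\le n-1$, and such that $c_i=c_j$ whenever $c_i$ and $c_j$ have the same vector. It is a $\mathcal{C}_\sigma$-path of a pattern $P$ if all its cells belong to $P$. A pattern $P$ is $\mathcal{C}_\sigma$-covered if for all $c,c'\in P$ there is a $\mathcal{C}_\sigma$-path of $P$ from $c$ to $c'$. The image vector of $\gamma$ is $\omega_\sigma(\gamma)=\sum_{i=1}^{n-1}\sigma_{\mathrm{rule}}(c_i,c_{i+1})$.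 **Consistency.** $\sigma$ is consistent on a $\mathcal{C}_\sigma$-covered pattern $P$ if for all cells $c,c'\in P$ and all $\mathcal{C}_\sigma$-paths $\gamma,\gamma'$ of $P$ from $c$ to $c'$ we have $\omega_\sigma(\gamma)=\omega_\sigma(\gamma')$. $\sigma$ is consistent on a set of patterns if it is consistent on every $\mathcal{C}_\sigma$-covered pattern belonging to that set. -}

module Defs where

open import Level using (Level)
open import Data.Empty using (⊥-elim)
open import Data.Integer.Base as ℤ using (ℤ; 0ℤ; 1ℤ; -1ℤ)
import Data.Integer.Properties as ℤₚ
open import Data.Integer.Tactic.RingSolver using (solve-∀)
open import Data.List.Base using (List; []; _∷_; map; head; last)
open import Data.List.Membership.Propositional using (_∈_)
open import Data.List.Membership.Propositional.Properties using (∈-map⁺; ∈-map⁻)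
open import Data.List.Relation.Binary.BagAndSetEquality using (_∼[_]_; set)
open import Data.List.Relation.Binary.Subset.Propositional using (_⊆_)
open import Data.List.Relation.Unary.All using (All)
open import Data.List.Relation.Unary.Any using (here; there)
open import Data.List.Relation.Unary.Linked using (Linked; []; [-]; _∷_)
open import Data.List.Relation.Unary.Unique.Propositional using (Unique)
open import Data.Maybe.Base using (just)
open import Data.Product.Base using (_×_; _,_; proj₁; proj₂; ∃; ∃₂; ∃-syntax)
open import Data.Sum.Base using (_⊎_; inj₁; inj₂)
open import Function.Bundles using (Equivalence)
open import Relation.Binary.PropositionalEquality
  using (_≡_; _≢_; refl; sym; trans; cong; cong₂; subst)
open import Relation.Unary using (Pred)

ℤ² : Set
ℤ² = ℤ × ℤ

infixl 6 _⊕_ _⊖_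
infix  8 ⊝_

_⊕_ : ℤ² → ℤ² → ℤ²
(a , b) ⊕ (c , d) = a ℤ.+ c , b ℤ.+ d

⊝_ : ℤ² → ℤ²
⊝ (a , b) = ℤ.- a , ℤ.- b

_⊖_ : ℤ² → ℤ² → ℤ²
u ⊖ v = u ⊕ ⊝ v

𝟎 : ℤ²
𝟎 = 0ℤ , 0ℤ

unitSteps : List ℤ²
unitSteps = (1ℤ , 0ℤ) ∷ (-1ℤ , 0ℤ) ∷ (0ℤ , 1ℤ) ∷ (0ℤ , -1ℤ) ∷ []

unitSquare : List ℤ²
unitSquare = (0ℤ , 0ℤ) ∷ (1ℤ , 0ℤ) ∷ (0ℤ , 1ℤ) ∷ (1ℤ , 1ℤ) ∷ []

private
  variable
    A   : Set
    ℓ m : Level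

Cell : Set → Set
Cell A = ℤ² × A

vec : Cell A → ℤ²
vec = proj₁

-- A finite set of cells is represented by a list; two lists denote the
-- same set when they are related by _∼[ set ]_.
record Pattern (A : Set) : Set where
  field
    cells    : List (Cell A)
    distinct : Unique (map vec cells)

open Pattern public

shift : ℤ² → Cell A → Cell A
shift w (v , t) = w ⊕ v , t

translate : ℤ² → List (Cell A) → List (Cell A)
translate w = map (shift w)

infix 4 _~_ _≈τ_

_~_ : Pattern A → Pattern A → Set
P ~ Q = ∃[ w ] translate w (cells P) ∼[ set ] cells Q

_≈τ_ : Pred (Pattern A) ℓ → Pred (Pattern A) m → Set _
𝒫 ≈τ 𝒬 = (∀ P → 𝒫 P → ∃[ Q ] 𝒬 Q × P ~ Q)
        × (∀ Q → 𝒬 Q → ∃[ P ] 𝒫 P × P ~ Q)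

TwoByTwo : Pred (Pattern A) _
TwoByTwo P = ∃[ w ] map vec (cells P) ∼[ set ] map (w ⊕_) unitSquare

Domino : Pred (Pattern A) _
Domino P = ∃₂ λ c c′ → (cells P ∼[ set ] c ∷ c′ ∷ []) × (vec c′ ⊖ vec c) ∈ unitSteps

Config : Set → Set
Config A = ℤ² → A

AppearsIn : Pattern A → Config A → Set
AppearsIn P x = ∃[ w ] (∀ {v t} → (v , t) ∈ translate w (cells P) → x v ≡ t)

patt : Pred (Config A) ℓ → Pred (Pattern A) ℓ
patt 𝒮 P = ∃[ x ] 𝒮 x × AppearsIn P x

DominoesOf : Pred (Pattern A) ℓ → Pred (Pattern A) ℓ
DominoesOf 𝒫 D =
  Domino D × (∃[ P ] 𝒫 P × ∃[ w ] translate w (cells D) ⊆ cells P)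

record Rule (A : Set) : Set where
  constructor _,_,_↦_
  field
    type₁ type₂ : A
    offset      : ℤ²
    image       : ℤ²

open Rule public

lhs lhsᵒ : Rule A → A × A × ℤ²
lhs  r = type₁ r , type₂ r , offset r
lhsᵒ r = type₂ r , type₁ r , ⊝ offset r

-- `deterministic` says that r itself is the only rule whose left-hand side is
-- that of r or its reversal; as offsets are nonzero, no rule realises the
-- reversal.
record Substitution (A : Set) : Set where
  field
    base          : A → Pattern A
    rules         : List (Rule A)
    nonzero       : ∀ {r} → r ∈ rules → offset r ≢ 𝟎
    deterministic : ∀ {r s} → r ∈ rules → s ∈ rules →
                    lhs s ≡ lhs r ⊎ lhs s ≡ lhsᵒ r → s ≡ r

open Substitution public

module _ (σ : Substitution A) where

  Starting : Pred (Pattern A) _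
  Starting C = ∃[ r ] r ∈ rules σ ×
    (cells C ∼[ set ] (𝟎 , type₁ r) ∷ (offset r , type₂ r) ∷ [])

  DominoComplete : Pred (Pattern A) ℓ → Set ℓ
  DominoComplete 𝒫 = Starting ≈τ DominoesOf 𝒫

  -- The graph of the partial function σ_rule.
  RuleValue : Cell A → Cell A → ℤ² → Set
  RuleValue (u , t) (u′ , t′) v =
      (t , t′ , (u′ ⊖ u) ↦ v) ∈ rules σ
    ⊎ (∃[ v′ ] (t′ , t , (u ⊖ u′) ↦ v′) ∈ rules σ × v ≡ ⊝ v′)

  Adjacent : Cell A → Cell A → Set
  Adjacent c c′ = ∃[ C ] Starting C ×
    ∃[ w ] translate w (cells C) ∼[ set ] c ∷ c′ ∷ []

  record IsPath (c c′ : Cell A) (γ : List (Cell A)) : Set where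
    field
      starts   : head γ ≡ just c
      ends     : last γ ≡ just c′
      adjacent : Linked Adjacent γ
      coherent : ∀ {d d′} → d ∈ γ → d′ ∈ γ → vec d ≡ vec d′ → d ≡ d′

  IsPathOf : Pattern A → Cell A → Cell A → List (Cell A) → Set
  IsPathOf P c c′ γ = IsPath c c′ γ × All (_∈ cells P) γ

  Covered : Pred (Pattern A) _
  Covered P = ∀ {c c′} → c ∈ cells P → c′ ∈ cells P → ∃[ γ ] IsPathOf P c c′ γ

  -- The graph of the image vector ω_σ: by ω-defined and ω-unique below, it
  -- relates every path to exactly one vector.
  data ω : List (Cell A) → ℤ² → Set where
    [-] : ∀ {c} → ω (c ∷ []) 𝟎
    _∷_ : ∀ {c d γ v w} → RuleValue c d v → ω (d ∷ γ) w → ω (c ∷ d ∷ γ) (v ⊕ w)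

  Consistent : Pred (Pattern A) _
  Consistent P = ∀ {c c′ γ γ′ w w′} → c ∈ cells P → c′ ∈ cells P →
    IsPathOf P c c′ γ → IsPathOf P c c′ γ′ → ω γ w → ω γ′ w′ → w ≡ w′

  ConsistentOn : Pred (Pattern A) ℓ → Set ℓ
  ConsistentOn 𝒫 = ∀ P → 𝒫 P → Covered P → Consistent P

private
  ⊝-⊖ : ∀ u v → u ⊖ v ≡ ⊝ (v ⊖ u)
  ⊝-⊖ (a , b) (c , d) = cong₂ _,_ (lem a c) (lem b d)
    where
    lem : ∀ x y → x ℤ.+ ℤ.- y ≡ ℤ.- (y ℤ.+ ℤ.- x)
    lem = solve-∀

  cancel : ∀ w u → u ≡ (w ⊕ u) ⊖ (w ⊕ 𝟎)
  cancel (a , b) (c , d) = cong₂ _,_ (lem a c) (lem b d)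
    where
    lem : ∀ x y → y ≡ (x ℤ.+ y) ℤ.+ ℤ.- (x ℤ.+ 0ℤ)
    lem = solve-∀

  self : ∀ u → u ⊖ u ≡ 𝟎
  self (a , b) = cong₂ _,_ (ℤₚ.+-inverseʳ a) (ℤₚ.+-inverseʳ b)

  self-inverse : ∀ {i} → i ≡ ℤ.- i → i ≡ 0ℤ
  self-inverse {ℤ.+ 0} _ = refl
  self-inverse {ℤ.+[1+ _ ]} ()
  self-inverse {ℤ.-[1+ _ ]} ()

module _ (σ : Substitution A) where

  private
    not-reversed : ∀ {r s} → r ∈ rules σ → s ∈ rules σ → lhs s ≢ lhsᵒ r
    not-reversed {r} r∈ s∈ eq with deterministic σ r∈ s∈ (inj₂ eq)
    ... | refl = nonzero σ r∈
      (cong₂ _,_ (self-inverse (cong (λ l → proj₁ (proj₂ (proj₂ l))) eq))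
                 (self-inverse (cong (λ l → proj₂ (proj₂ (proj₂ l))) eq)))

  RuleValue-unique : ∀ c d {v w} → RuleValue σ c d v → RuleValue σ c d w → v ≡ w
  RuleValue-unique _ _ (inj₁ r∈) (inj₁ s∈) =
    cong image (deterministic σ s∈ r∈ (inj₁ refl))
  RuleValue-unique (u , t) (u′ , t′) (inj₁ r∈) (inj₂ (_ , s∈ , _)) =
    ⊥-elim (not-reversed s∈ r∈ (cong (λ z → t , t′ , z) (⊝-⊖ u′ u)))
  RuleValue-unique (u , t) (u′ , t′) (inj₂ (_ , r∈ , _)) (inj₁ s∈) =
    ⊥-elim (not-reversed r∈ s∈ (cong (λ z → t , t′ , z) (⊝-⊖ u′ u)))
  RuleValue-unique _ _ (inj₂ (_ , r∈ , refl)) (inj₂ (_ , s∈ , refl)) =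
    cong (λ r → ⊝ image r) (deterministic σ s∈ r∈ (inj₁ refl))

  ω-unique : ∀ {γ v w} → ω σ γ v → ω σ γ w → v ≡ w
  ω-unique [-] [-] = refl
  ω-unique (_∷_ {c} {d} r p) (s ∷ q) = cong₂ _⊕_ (RuleValue-unique c d r s) (ω-unique p q)

  RuleValue-defined : ∀ {c d} → Adjacent σ c d → ∃[ v ] RuleValue σ c d v
  RuleValue-defined {c} {d} (C , ((t , t′ , u ↦ v) , r∈ , C∼) , w , wC∼) =
    go (Equivalence.to wC∼ (∈-map⁺ (shift w) (Equivalence.from C∼ (here refl))))
       (Equivalence.to wC∼ (∈-map⁺ (shift w) (Equivalence.from C∼ (there (here refl)))))
    where
    e₁ = w ⊕ 𝟎 , t
    e₂ = w ⊕ u , t′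

    coincide : e₁ ≢ e₂
    coincide eq = nonzero σ r∈
      (trans (cancel w u) (trans (cong (_⊖ (w ⊕ 𝟎)) (sym (cong vec eq))) (self (w ⊕ 𝟎))))

    r∈′ : (t , t′ , ((w ⊕ u) ⊖ (w ⊕ 𝟎)) ↦ v) ∈ rules σ
    r∈′ = subst (λ z → (t , t′ , z ↦ v) ∈ rules σ) (cancel w u) r∈

    go : e₁ ∈ c ∷ d ∷ [] → e₂ ∈ c ∷ d ∷ [] → ∃[ z ] RuleValue σ c d z
    go (here p) (here q) = ⊥-elim (coincide (trans p (sym q)))
    go (here refl) (there (here refl)) = v , inj₁ r∈′
    go (there (here refl)) (here refl) = ⊝ v , inj₂ (v , r∈′ , refl)
    go (there (here p)) (there (here q)) = ⊥-elim (coincide (trans p (sym q)))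

  ω-defined : ∀ {c c′ γ} → IsPath σ c c′ γ → ∃[ w ] ω σ γ w
  ω-defined path = go (IsPath.starts path) (IsPath.adjacent path)
    where
    go : ∀ {c γ} → head γ ≡ just c → Linked (Adjacent σ) γ → ∃[ w ] ω σ γ w
    go _ [-] = 𝟎 , [-]
    go _ (a ∷ as) with RuleValue-defined a | go refl as
    ... | v , r | w , p = v ⊕ w , r ∷ p

{-# OPTIONS --safe #-}
-- The rule values along a configuration x of 𝒮 form a vector field on the edges
-- of the grid ℤ²: domino-completeness defines it on every edge of x and on
-- unit edges only, and consistency on the 2×2 patterns makes it curl-free.
-- On the whole (simply connected) grid it is therefore the difference of a
-- potential φ, and the image vector of a path in a pattern of x is the
-- difference of φ at its endpoints, whether or not the pattern itself has holes.
module Submission where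

open import Defs
open import Level using (Level)
open import Data.Nat.Base using (ℕ)
open import Data.Fin.Base using (Fin)
open import Data.List.Base using (List)
open import Data.List.Membership.Propositional using (_∈_)
open import Function.Bundles using (_↔_; _⇔_)
open import Relation.Unary using (Pred; _∩_)

open import Data.Empty using (⊥-elim)
open import Data.Integer.Base as ℤ using (ℤ; 0ℤ; 1ℤ)
import Data.Integer.Properties as ℤₚ
open import Algebra.Properties.AbelianGroup ℤₚ.+-0-abelianGroup
  using () renaming (∙-cancelʳ to +-cancelʳ)
open import Data.Integer.Tactic.RingSolver using (solve-∀)
open import Data.List.Base using ([]; _∷_; map; head; last)
import Data.List.Membership.DecPropositional as DecMembership
open import Data.List.Membership.Propositional using (_∉_; find)
open import Data.List.Membership.Propositional.Properties using (∈-map⁺; ∈-map⁻)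
open import Data.List.Relation.Binary.BagAndSetEquality using (_∼[_]_; set)
open import Data.List.Relation.Unary.All as All using (All; []; _∷_)
open import Data.List.Relation.Unary.AllPairs using ([]; _∷_)
open import Data.List.Relation.Unary.Any as Any using (here; there)
open import Data.List.Relation.Unary.Linked using ([-]; _∷_)
open import Data.List.Relation.Unary.Unique.Propositional using (Unique)
open import Data.List.Relation.Unary.Unique.Propositional.Properties using (map⁺)
import Data.List.Relation.Unary.Unique.DecPropositional as DecUnique
open import Data.Maybe.Base using (just)
open import Data.Nat.Base using (zero; suc)
open import Data.Product.Base using (_×_; _,_; proj₁; proj₂; ∃; ∃-syntax; map₂)
open import Data.Product.Properties using (≡-dec)
open import Data.Sum.Base using (_⊎_; inj₁; inj₂)
open import Function.Base using (_∘_; id)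
open import Function.Bundles using (Equivalence; mk⇔)
open import Relation.Binary.Definitions using (DecidableEquality)
open import Relation.Binary.PropositionalEquality
  using (_≡_; _≢_; refl; sym; trans; cong; cong₂; subst; module ≡-Reasoning)
open import Relation.Nullary.Decidable using (from-yes; _⊎-dec_; _×-dec_)

open Equivalence using (to; from)

private
  variable
    A : Set
    ℓ : Level

-- Vector arithmetic, unit steps and the unit square

_≟_ : DecidableEquality ℤ²
_≟_ = ≡-dec ℤₚ._≟_ ℤₚ._≟_

open DecMembership _≟_ using (_∈?_)
open DecUnique _≟_ using (unique?)

⊕-assoc : ∀ u v w → (u ⊕ v) ⊕ w ≡ u ⊕ (v ⊕ w)
⊕-assoc (a , b) (c , d) (e , f) = cong₂ _,_ (ℤₚ.+-assoc a c e) (ℤₚ.+-assoc b d f)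

⊕-identityˡ : ∀ v → 𝟎 ⊕ v ≡ v
⊕-identityˡ (a , b) = cong₂ _,_ (ℤₚ.+-identityˡ a) (ℤₚ.+-identityˡ b)

⊕-identityʳ : ∀ v → v ⊕ 𝟎 ≡ v
⊕-identityʳ (a , b) = cong₂ _,_ (ℤₚ.+-identityʳ a) (ℤₚ.+-identityʳ b)

⊝-involutive : ∀ v → ⊝ ⊝ v ≡ v
⊝-involutive (a , b) = cong₂ _,_ (ℤₚ.neg-involutive a) (ℤₚ.neg-involutive b)

⊝-⊖ : ∀ u v → ⊝ (u ⊖ v) ≡ v ⊖ u
⊝-⊖ (a , b) (c , d) = cong₂ _,_ (lem a c) (lem b d)
  where
  lem : ∀ x y → ℤ.- (x ℤ.+ ℤ.- y) ≡ y ℤ.+ ℤ.- x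
  lem = solve-∀

⊕-⊖-cancel : ∀ u v → u ⊕ (v ⊖ u) ≡ v
⊕-⊖-cancel (a , b) (c , d) = cong₂ _,_ (lem a c) (lem b d)
  where
  lem : ∀ x y → x ℤ.+ (y ℤ.+ ℤ.- x) ≡ y
  lem = solve-∀

⊕-⊖-translate : ∀ w u v → (w ⊕ u) ⊖ (w ⊕ v) ≡ u ⊖ v
⊕-⊖-translate (a , b) (c , d) (e , f) = cong₂ _,_ (lem a c e) (lem b d f)
  where
  lem : ∀ x y z → (x ℤ.+ y) ℤ.+ ℤ.- (x ℤ.+ z) ≡ y ℤ.+ ℤ.- z
  lem = solve-∀

⊕-inverseʳ : ∀ v → v ⊖ v ≡ 𝟎
⊕-inverseʳ (a , b) = cong₂ _,_ (ℤₚ.+-inverseʳ a) (ℤₚ.+-inverseʳ b)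

⊕-transpose : ∀ u v w → u ⊖ v ≡ w → u ≡ w ⊕ v
⊕-transpose (a , b) (c , d) _ refl = cong₂ _,_ (lem a c) (lem b d)
  where
  lem : ∀ x y → x ≡ (x ℤ.+ ℤ.- y) ℤ.+ y
  lem = solve-∀

⊝-cancelˡ : ∀ w v → ⊝ w ⊕ (w ⊕ v) ≡ v
⊝-cancelˡ (a , b) (c , d) = cong₂ _,_ (lem a c) (lem b d)
  where
  lem : ∀ x y → ℤ.- x ℤ.+ (x ℤ.+ y) ≡ y
  lem = solve-∀

⊕-cancelˡ : ∀ u {v w} → u ⊕ v ≡ u ⊕ w → v ≡ w
⊕-cancelˡ u {v} {w} eq = trans (sym (⊝-cancelˡ u v)) (trans (cong (⊝ u ⊕_) eq) (⊝-cancelˡ u w))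

∈unitSteps-⊝ : ∀ {e} → e ∈ unitSteps → ⊝ e ∈ unitSteps
∈unitSteps-⊝ (here refl) = there (here refl)
∈unitSteps-⊝ (there (here refl)) = here refl
∈unitSteps-⊝ (there (there (here refl))) = there (there (there (here refl)))
∈unitSteps-⊝ (there (there (there (here refl)))) = there (there (here refl))

𝟎∉unitSteps : 𝟎 ∉ unitSteps
𝟎∉unitSteps (here ())
𝟎∉unitSteps (there (here ()))
𝟎∉unitSteps (there (there (here ())))
𝟎∉unitSteps (there (there (there (here ()))))

unitSquare-unique : Unique unitSquare
unitSquare-unique = from-yes (unique? unitSquare)

-- Equal corners fall under the second alternative, by a detour.
unitSquare-diameter : ∀ {s s′} → s ∈ unitSquare → s′ ∈ unitSquare →
  (s′ ⊖ s) ∈ unitSteps ⊎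
  (∃[ m ] m ∈ unitSquare × (m ⊖ s) ∈ unitSteps × (s′ ⊖ m) ∈ unitSteps)
unitSquare-diameter s∈ s′∈ with All.lookup (All.lookup decided s∈) s′∈
  where
  decided = from-yes (All.all? (λ s → All.all? (λ s′ →
    ((s′ ⊖ s) ∈? unitSteps) ⊎-dec
    Any.any? (λ m → ((m ⊖ s) ∈? unitSteps) ×-dec ((s′ ⊖ m) ∈? unitSteps)) unitSquare)
    unitSquare) unitSquare)
... | inj₁ step = inj₁ step
... | inj₂ detour = inj₂ (find detour)

-- Sums over integer intervals and potentials on the grid

-- The discrete antiderivative of `f` that vanishes at 0. At a negative `i` it is minus the sum over
-- the integers from `i` to -1, which makes `∑-suc` hold at every integer.
∑ : (ℤ → ℤ) → ℤ → ℤ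
∑ f (ℤ.+ zero) = 0ℤ
∑ f (ℤ.+ suc n) = ∑ f (ℤ.+ n) ℤ.+ f (ℤ.+ n)
∑ f ℤ.-[1+ zero ] = ℤ.- f ℤ.-[1+ zero ]
∑ f ℤ.-[1+ suc n ] = ∑ f ℤ.-[1+ n ] ℤ.- f ℤ.-[1+ suc n ]

∑-suc : ∀ f i → ∑ f (ℤ.suc i) ≡ ∑ f i ℤ.+ f i
∑-suc f (ℤ.+ n) = refl
∑-suc f ℤ.-[1+ zero ] = sym (ℤₚ.+-inverseˡ (f ℤ.-[1+ zero ]))
∑-suc f ℤ.-[1+ suc n ] = lem (∑ f ℤ.-[1+ n ]) (f ℤ.-[1+ suc n ])
  where
  lem : ∀ x y → x ≡ (x ℤ.+ ℤ.- y) ℤ.+ y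
  lem = solve-∀

ℤ-induction : (Q : ℤ → Set) → Q 0ℤ →
  (∀ {i} → Q i → Q (ℤ.suc i)) → (∀ {i} → Q (ℤ.suc i) → Q i) → ∀ i → Q i
ℤ-induction Q base up down (ℤ.+ zero) = base
ℤ-induction Q base up down (ℤ.+ suc n) = up (ℤ-induction Q base up down (ℤ.+ n))
ℤ-induction Q base up down ℤ.-[1+ zero ] = down base
ℤ-induction Q base up down ℤ.-[1+ suc n ] = down (ℤ-induction Q base up down ℤ.-[1+ n ])

-- `right a b` and `up a b` are the values on the edges leaving (a , b) to the right and upwards.
-- Around each unit cell, right-then-up must agree with up-then-right.
CurlFree : (right up : ℤ → ℤ → ℤ) → Set
CurlFree right up = ∀ a b →
  right a b ℤ.+ up (ℤ.suc a) b ≡ up a b ℤ.+ right a (ℤ.suc b)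

module Potential (right up : ℤ → ℤ → ℤ) where

  -- Integrates the field from the origin along the horizontal axis to (a , 0), then up column `a`.
  -- Since the last leg is vertical, a step up merely extends it.
  potential : ℤ → ℤ → ℤ
  potential a b = ∑ (λ i → right i 0ℤ) a ℤ.+ ∑ (up a) b

  potential-up : ∀ a b → potential a (ℤ.suc b) ≡ potential a b ℤ.+ up a b
  potential-up a b =
    trans (cong (ℤ._+_ (∑ _ a)) (∑-suc (up a) b)) (sym (ℤₚ.+-assoc (∑ _ a) _ _))

  module _ (curl : CurlFree right up) where

    private
      -- The strip between columns `a` and `a + 1` is a stack of unit cells; adding them one at a
      -- time moves the horizontal edge from height 0 to height `b`.
      transport : ∀ a b → right a 0ℤ ℤ.+ ∑ (up (ℤ.suc a)) b ≡ ∑ (up a) b ℤ.+ right a b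
      transport a = ℤ-induction
        (λ b → right a 0ℤ ℤ.+ ∑ (up (ℤ.suc a)) b ≡ ∑ (up a) b ℤ.+ right a b)
        (ℤₚ.+-comm (right a 0ℤ) 0ℤ)
        (λ {b} eq → begin
          right a 0ℤ ℤ.+ S′ (ℤ.suc b)                ≡⟨ split b ⟩
          (right a 0ℤ ℤ.+ S′ b) ℤ.+ up (ℤ.suc a) b   ≡⟨ cong (ℤ._+ up (ℤ.suc a) b) eq ⟩
          (S b ℤ.+ right a b) ℤ.+ up (ℤ.suc a) b     ≡⟨ exchange b ⟩
          S (ℤ.suc b) ℤ.+ right a (ℤ.suc b)          ∎)
        -- Going down, the cell is removed: adding its right edge to both sides lets the upward
        -- computation be run in reverse.
        (λ {b} eq → +-cancelʳ (up (ℤ.suc a) b) _ _ (begin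
          (right a 0ℤ ℤ.+ S′ b) ℤ.+ up (ℤ.suc a) b   ≡⟨ split b ⟨
          right a 0ℤ ℤ.+ S′ (ℤ.suc b)                ≡⟨ eq ⟩
          S (ℤ.suc b) ℤ.+ right a (ℤ.suc b)          ≡⟨ exchange b ⟨
          (S b ℤ.+ right a b) ℤ.+ up (ℤ.suc a) b     ∎))
        where
        open ≡-Reasoning
        S S′ : ℤ → ℤ
        S = ∑ (up a)
        S′ = ∑ (up (ℤ.suc a))

        split : ∀ b → right a 0ℤ ℤ.+ S′ (ℤ.suc b) ≡
                      (right a 0ℤ ℤ.+ S′ b) ℤ.+ up (ℤ.suc a) b
        split b = trans (cong (ℤ._+_ (right a 0ℤ)) (∑-suc (up (ℤ.suc a)) b))
                        (sym (ℤₚ.+-assoc (right a 0ℤ) _ _))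

        exchange : ∀ b → (S b ℤ.+ right a b) ℤ.+ up (ℤ.suc a) b ≡
                         S (ℤ.suc b) ℤ.+ right a (ℤ.suc b)
        exchange b = begin
          (S b ℤ.+ right a b) ℤ.+ up (ℤ.suc a) b     ≡⟨ ℤₚ.+-assoc (S b) _ _ ⟩
          S b ℤ.+ (right a b ℤ.+ up (ℤ.suc a) b)     ≡⟨ cong (ℤ._+_ (S b)) (curl a b) ⟩
          S b ℤ.+ (up a b ℤ.+ right a (ℤ.suc b))     ≡⟨ ℤₚ.+-assoc (S b) _ _ ⟨
          (S b ℤ.+ up a b) ℤ.+ right a (ℤ.suc b)     ≡⟨ cong (ℤ._+ _) (∑-suc (up a) b) ⟨
          S (ℤ.suc b) ℤ.+ right a (ℤ.suc b)          ∎

    -- Extending the horizontal leg changes the column climbed afterwards; `transport` trades the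
    -- new column for the old one followed by a step right at height `b`.
    potential-right : ∀ a b → potential (ℤ.suc a) b ≡ potential a b ℤ.+ right a b
    potential-right a b = begin
      ∑ r (ℤ.suc a) ℤ.+ ∑ (up (ℤ.suc a)) b           ≡⟨ cong (ℤ._+ _) (∑-suc r a) ⟩
      (∑ r a ℤ.+ r a) ℤ.+ ∑ (up (ℤ.suc a)) b         ≡⟨ ℤₚ.+-assoc (∑ r a) _ _ ⟩
      ∑ r a ℤ.+ (r a ℤ.+ ∑ (up (ℤ.suc a)) b)         ≡⟨ cong (ℤ._+_ (∑ r a)) (transport a b) ⟩
      ∑ r a ℤ.+ (∑ (up a) b ℤ.+ right a b)           ≡⟨ ℤₚ.+-assoc (∑ r a) _ _ ⟨
      (∑ r a ℤ.+ ∑ (up a) b) ℤ.+ right a b           ∎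
      where
      open ≡-Reasoning
      r : ℤ → ℤ
      r i = right i 0ℤ

-- Patterns up to translation

shift-shift : ∀ w w′ (c : Cell A) → shift w (shift w′ c) ≡ shift (w ⊕ w′) c
shift-shift w w′ (v , t) = cong (_, t) (sym (⊕-assoc w w′ v))

~-sym : (P Q : Pattern A) → P ~ Q → Q ~ P
~-sym P Q (w , eq) = ⊝ w , λ {c} → mk⇔ (back c) (forth c)
  where
  unshift : ∀ c → shift (⊝ w) (shift w c) ≡ c
  unshift (v , t) = cong (_, t) (⊝-cancelˡ w v)

  back : ∀ c → c ∈ translate (⊝ w) (cells Q) → c ∈ cells P
  back c c∈ with ∈-map⁻ (shift (⊝ w)) c∈
  ... | q , q∈ , refl with ∈-map⁻ (shift w) (from eq q∈)
  ... | p , p∈ , refl = subst (_∈ cells P) (sym (unshift p)) p∈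

  forth : ∀ c → c ∈ cells P → c ∈ translate (⊝ w) (cells Q)
  forth c c∈ = subst (_∈ translate (⊝ w) (cells Q)) (unshift c)
    (∈-map⁺ (shift (⊝ w)) (to eq (∈-map⁺ (shift w) c∈)))

appearsIn-resp-~ : (P Q : Pattern A) {x : Config A} → P ~ Q → AppearsIn Q x → AppearsIn P x
appearsIn-resp-~ P Q {x} (w , eq) (w′ , app) = w′ ⊕ w , typed
  where
  typed : ∀ {v t} → (v , t) ∈ translate (w′ ⊕ w) (cells P) → x v ≡ t
  typed c∈ with ∈-map⁻ (shift (w′ ⊕ w)) c∈
  ... | c , c∈P , refl = app (subst (_∈ translate w′ (cells Q)) (shift-shift w′ w c)
                                (∈-map⁺ (shift w′) (to eq (∈-map⁺ (shift w) c∈P))))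

-- Supplies the `coherent` condition of a path as soon as all its cells lie in one pattern.
distinct-coherent : {cs : List (Cell A)} → Unique (map vec cs) →
  ∀ {c d} → c ∈ cs → d ∈ cs → vec c ≡ vec d → c ≡ d
distinct-coherent _ (here refl) (here refl) _ = refl
distinct-coherent (c≢ ∷ _) (here refl) (there d∈) eq =
  ⊥-elim (All.lookup c≢ (∈-map⁺ vec d∈) eq)
distinct-coherent (d≢ ∷ _) (there c∈) (here refl) eq =
  ⊥-elim (All.lookup d≢ (∈-map⁺ vec c∈) (sym eq))
distinct-coherent (_ ∷ u) (there c∈) (there d∈) eq = distinct-coherent u c∈ d∈ eq

pairPattern : (c d : Cell A) → vec c ≢ vec d → Pattern A
pairPattern c d c≢d = record { cells = c ∷ d ∷ [] ; distinct = (c≢d ∷ []) ∷ [] ∷ [] }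

-- Windows of a configuration

cell : Config A → ℤ² → Cell A
cell x v = v , x v

square : Config A → ℤ² → Pattern A
square x v = record
  { cells    = map (λ s → cell x (v ⊕ s)) unitSquare
  ; distinct = map⁺ (⊕-cancelˡ v) unitSquare-unique
  }

square-twoByTwo : (x : Config A) (v : ℤ²) → TwoByTwo (square x v)
square-twoByTwo x v = v , mk⇔ id id

square-appearsIn : (x : Config A) (v : ℤ²) → AppearsIn (square x v) x
square-appearsIn x v = 𝟎 , typed
  where
  typed : ∀ {u t} → (u , t) ∈ translate 𝟎 (cells (square x v)) → x u ≡ t
  typed c∈ with ∈-map⁻ (shift 𝟎) c∈
  ... | d , d∈ , refl with ∈-map⁻ (λ s → cell x (v ⊕ s)) d∈
  ... | s , s∈ , refl = cong x (⊕-identityˡ (v ⊕ s))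

-- Rule values under translation and reversal, and paths inside a pattern

module _ (σ : Substitution A) where

  RuleValue-shift : ∀ w c d {z} → RuleValue σ c d z → RuleValue σ (shift w c) (shift w d) z
  RuleValue-shift w (u , t) (u′ , t′) {z} (inj₁ r∈) =
    inj₁ (subst (λ o → (t , t′ , o ↦ z) ∈ rules σ) (sym (⊕-⊖-translate w u′ u)) r∈)
  RuleValue-shift w (u , t) (u′ , t′) (inj₂ (z , r∈ , eq)) =
    inj₂ (z , subst (λ o → (t′ , t , o ↦ z) ∈ rules σ) (sym (⊕-⊖-translate w u u′)) r∈ , eq)

  RuleValue-unshift : ∀ w c d {z} → RuleValue σ (shift w c) (shift w d) z → RuleValue σ c d z
  RuleValue-unshift w (u , t) (u′ , t′) {z} (inj₁ r∈) =
    inj₁ (subst (λ o → (t , t′ , o ↦ z) ∈ rules σ) (⊕-⊖-translate w u′ u) r∈)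
  RuleValue-unshift w (u , t) (u′ , t′) (inj₂ (z , r∈ , eq)) =
    inj₂ (z , subst (λ o → (t′ , t , o ↦ z) ∈ rules σ) (⊕-⊖-translate w u u′) r∈ , eq)

  RuleValue-reverse : ∀ c d {z} → RuleValue σ c d z → RuleValue σ d c (⊝ z)
  RuleValue-reverse _ _ {z} (inj₁ r∈) = inj₂ (z , r∈ , refl)
  RuleValue-reverse (u , t) (u′ , t′) (inj₂ (z , r∈ , refl)) =
    inj₁ (subst (λ i → (t′ , t , (u ⊖ u′) ↦ i) ∈ rules σ) (sym (⊝-involutive z)) r∈)

  module _ (P : Pattern A) where

    singletonPath : ∀ {c} → c ∈ cells P → IsPathOf σ P c c (c ∷ [])
    singletonPath c∈ = record
      { starts = refl ; ends = refl ; adjacent = [-]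
      ; coherent = λ { (here refl) (here refl) _ → refl } } , c∈ ∷ []

    -- Coherence of the longer path is drawn afresh from the distinct vectors of `P`, since the new
    -- cell may revisit a vector already on the path.
    consPath : ∀ {c d e γ} → c ∈ cells P → Adjacent σ c d →
               IsPathOf σ P d e (d ∷ γ) → IsPathOf σ P c e (c ∷ d ∷ γ)
    consPath c∈ c~d (path , inP) = record
      { starts = refl ; ends = IsPath.ends path ; adjacent = c~d ∷ IsPath.adjacent path
      ; coherent = λ d∈ d′∈ → distinct-coherent (distinct P) (All.lookup all d∈) (All.lookup all d′∈)
      } , all
      where all = c∈ ∷ inP

  -- Consequences of domino-completeness

  module _ {𝒫 : Pred (Pattern A) ℓ} (complete : DominoComplete σ 𝒫) where

    -- The starting pattern of `r` is a translate of a domino, so its offset is the difference of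
    -- the two domino cells, taken in one order or the other.
    offset-unit : ∀ {r} → r ∈ rules σ → offset r ∈ unitSteps
    offset-unit {r} r∈ with proj₁ complete C (r , r∈ , mk⇔ id id)
      where C = pairPattern (𝟎 , type₁ r) (offset r , type₂ r) (nonzero σ r∈ ∘ sym)
    ... | D , ((e , e′ , D∼ , step) , _) , w , C~D =
      go (to D∼ (to C~D (here refl))) (to D∼ (to C~D (there (here refl))))
      where
      u = offset r

      u-as-difference : (w ⊕ u) ⊖ (w ⊕ 𝟎) ≡ u
      u-as-difference = trans (⊕-⊖-translate w u 𝟎) (⊕-identityʳ u)

      distinctCells : ∀ {f} → (w ⊕ 𝟎 , type₁ r) ≡ f → (w ⊕ u , type₂ r) ≢ f
      distinctCells p q = nonzero σ r∈ (sym (⊕-cancelˡ w (cong vec (trans p (sym q)))))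

      go : (w ⊕ 𝟎 , type₁ r) ∈ e ∷ e′ ∷ [] → (w ⊕ u , type₂ r) ∈ e ∷ e′ ∷ [] → u ∈ unitSteps
      go (here p) (here q) = ⊥-elim (distinctCells p q)
      go (here refl) (there (here refl)) = subst (_∈ unitSteps) u-as-difference step
      -- Here the cells are matched in the opposite order, so the domino gives the negated offset.
      go (there (here refl)) (here refl) = subst (_∈ unitSteps)
        (trans (⊝-⊖ (w ⊕ 𝟎) (w ⊕ u)) u-as-difference) (∈unitSteps-⊝ step)
      go (there (here p)) (there (here q)) = ⊥-elim (distinctCells p q)

    RuleValue-unit : ∀ c d {z} → RuleValue σ c d z → (vec d ⊖ vec c) ∈ unitSteps
    RuleValue-unit _ _ (inj₁ r∈) = offset-unit r∈
    RuleValue-unit c d (inj₂ (_ , r∈ , _)) =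
      subst (_∈ unitSteps) (⊝-⊖ (vec c) (vec d)) (∈unitSteps-⊝ (offset-unit r∈))

    -- The two cells form a domino inside `P`, and completeness turns every such domino into a
    -- translate of a starting pattern.
    unit-adjacent : ∀ {P c d} → 𝒫 P → c ∈ cells P → d ∈ cells P →
                    (vec d ⊖ vec c) ∈ unitSteps → Adjacent σ c d
    unit-adjacent {P} {c} {d} P∈ c∈ d∈ step
      with proj₂ complete D ((c , d , mk⇔ id id , step) , P , P∈ , 𝟎 , D⊆P)
      where
      D = pairPattern c d λ eq → 𝟎∉unitSteps (subst (_∈ unitSteps)
            (trans (cong (vec d ⊖_) eq) (⊕-inverseʳ (vec d))) step)

      D⊆P : ∀ {e} → e ∈ translate 𝟎 (c ∷ d ∷ []) → e ∈ cells P
      D⊆P (here refl) = subst (_∈ cells P) (cong (_, _) (sym (⊕-identityˡ _))) c∈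
      D⊆P (there (here refl)) = subst (_∈ cells P) (cong (_, _) (sym (⊕-identityˡ _))) d∈
    ... | C , starting , w , C~D = C , starting , w , C~D

-- Consistency on all patterns versus consistency on the squares

module _ {𝒮 : Pred (Config A) ℓ} {Ps : List (Pattern A)}
         (squares : (_∈ Ps) ≈τ (TwoByTwo ∩ patt 𝒮))
         (σ : Substitution A) (complete : DominoComplete σ (_∈ Ps)) where

  -- Each listed square is a translate of a pattern appearing in 𝒮, hence belongs to `patt 𝒮`
  -- itself.
  patt-consistent⇒squares-consistent : ConsistentOn σ (patt 𝒮) → ConsistentOn σ (_∈ Ps)
  patt-consistent⇒squares-consistent consistent P P∈ with proj₁ squares P P∈
  ... | Q , (_ , x , x∈ , app) , P~Q = consistent P (x , x∈ , appearsIn-resp-~ P Q P~Q app)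

  module _ (consistent : ConsistentOn σ (_∈ Ps)) {x : Config A} (x∈ : 𝒮 x) where

    private
      Value : ℤ² → ℤ² → ℤ² → Set
      Value u v = RuleValue σ (cell x u) (cell x v)

    -- `Ps` lists squares only up to translation. Consistency is therefore applied to the listed
    -- copy `P` of the window at `v`, and the results are carried back to `x` along `w`.
    module Square {P : Pattern A} (P∈ : P ∈ Ps) (v w : ℤ²)
                  (square~P : translate w (cells (square x v)) ∼[ set ] cells P) where

      private
        corner : ℤ² → Cell A
        corner s = shift w (cell x (v ⊕ s))

        corner∈ : ∀ s → s ∈ unitSquare → corner s ∈ cells P
        corner∈ s s∈ = to square~P (∈-map⁺ (shift w) (∈-map⁺ (λ s → cell x (v ⊕ s)) s∈))

        corner-surjective : ∀ {c} → c ∈ cells P → ∃[ s ] s ∈ unitSquare × c ≡ corner s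
        corner-surjective c∈ with ∈-map⁻ (shift w) (from square~P c∈)
        ... | d , d∈ , refl with ∈-map⁻ (λ s → cell x (v ⊕ s)) d∈
        ... | s , s∈ , refl = s , s∈ , refl

        corner-adjacent : ∀ s s′ → s ∈ unitSquare → s′ ∈ unitSquare →
                          (s′ ⊖ s) ∈ unitSteps → Adjacent σ (corner s) (corner s′)
        corner-adjacent s s′ s∈ s′∈ step =
          unit-adjacent σ complete P∈ (corner∈ s s∈) (corner∈ s′ s′∈)
            (subst (_∈ unitSteps) (sym (trans (⊕-⊖-translate w (v ⊕ s′) (v ⊕ s))
                                              (⊕-⊖-translate v s′ s))) step)

        detourPath : ∀ s m s′ → s ∈ unitSquare → m ∈ unitSquare → s′ ∈ unitSquare →
                     (m ⊖ s) ∈ unitSteps → (s′ ⊖ m) ∈ unitSteps →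
                     IsPathOf σ P (corner s) (corner s′) (corner s ∷ corner m ∷ corner s′ ∷ [])
        detourPath s m s′ s∈ m∈ s′∈ step step′ =
          consPath σ P (corner∈ s s∈) (corner-adjacent s m s∈ m∈ step)
            (consPath σ P (corner∈ m m∈) (corner-adjacent m s′ m∈ s′∈ step′)
              (singletonPath σ P (corner∈ s′ s′∈)))

        -- `ConsistentOn` speaks of covered patterns only, so this unlocks the hypothesis for `P`.
        -- Any two corners are joined by one or two unit steps.
        covered : Covered σ P
        covered c∈ c′∈ with corner-surjective c∈ | corner-surjective c′∈
        ... | s , s∈ , refl | s′ , s′∈ , refl with unitSquare-diameter s∈ s′∈
        ... | inj₁ step = _ , consPath σ P (corner∈ s s∈) (corner-adjacent s s′ s∈ s′∈ step)
                                (singletonPath σ P (corner∈ s′ s′∈))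
        ... | inj₂ (m , m∈ , step , step′) = _ , detourPath s m s′ s∈ m∈ s′∈ step step′

      value-defined : ∀ s s′ → s ∈ unitSquare → s′ ∈ unitSquare →
                      (s′ ⊖ s) ∈ unitSteps → ∃ (Value (v ⊕ s) (v ⊕ s′))
      value-defined s s′ s∈ s′∈ step =
        map₂ (RuleValue-unshift σ w (cell x (v ⊕ s)) (cell x (v ⊕ s′)))
          (RuleValue-defined σ {corner s} {corner s′} (corner-adjacent s s′ s∈ s′∈ step))

      -- The paths through `m` and through `m′` have the same ends and stay inside `P`, so
      -- consistency equates their image vectors.
      value-square : ∀ s m m′ s′ {z₁ z₂ z₃ z₄} →
        s ∈ unitSquare → m ∈ unitSquare → m′ ∈ unitSquare → s′ ∈ unitSquare →
        (m ⊖ s) ∈ unitSteps → (s′ ⊖ m) ∈ unitSteps →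
        (m′ ⊖ s) ∈ unitSteps → (s′ ⊖ m′) ∈ unitSteps →
        Value (v ⊕ s) (v ⊕ m) z₁ → Value (v ⊕ m) (v ⊕ s′) z₂ →
        Value (v ⊕ s) (v ⊕ m′) z₃ → Value (v ⊕ m′) (v ⊕ s′) z₄ →
        z₁ ⊕ z₂ ≡ z₃ ⊕ z₄
      value-square s m m′ s′ {z₁} {z₂} {z₃} {z₄}
                   s∈ m∈ m′∈ s′∈ e₁ e₂ e₃ e₄ val₁ val₂ val₃ val₄ = begin
        -- The empty sum at the last cell of a path leaves a trailing `𝟎` in each image vector.
        z₁ ⊕ z₂         ≡⟨ cong (z₁ ⊕_) (⊕-identityʳ z₂) ⟨
        z₁ ⊕ (z₂ ⊕ 𝟎)   ≡⟨ consistent P P∈ covered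
                             {corner s} {corner s′} {detour m} {detour m′}
                             {z₁ ⊕ (z₂ ⊕ 𝟎)} {z₃ ⊕ (z₄ ⊕ 𝟎)}
                             (corner∈ s s∈) (corner∈ s′ s′∈)
                             (detourPath s m s′ s∈ m∈ s′∈ e₁ e₂)
                             (detourPath s m′ s′ s∈ m′∈ s′∈ e₃ e₄)
                             (detour-ω m z₁ z₂ val₁ val₂)
                             (detour-ω m′ z₃ z₄ val₃ val₄) ⟩
        z₃ ⊕ (z₄ ⊕ 𝟎)   ≡⟨ cong (z₃ ⊕_) (⊕-identityʳ z₄) ⟩
        z₃ ⊕ z₄         ∎
        where
        open ≡-Reasoning

        detour : ℤ² → List (Cell A)
        detour r = corner s ∷ corner r ∷ corner s′ ∷ []

        detour-ω : ∀ r z z′ → Value (v ⊕ s) (v ⊕ r) z → Value (v ⊕ r) (v ⊕ s′) z′ →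
                   ω σ (detour r) (z ⊕ (z′ ⊕ 𝟎))
        detour-ω r z z′ val val′ =
          _∷_ {v = z} {w = z′ ⊕ 𝟎} (shifted s r val)
            (_∷_ {v = z′} {w = 𝟎} (shifted r s′ val′) [-])
          where
          shifted : ∀ r r′ {z} → Value (v ⊕ r) (v ⊕ r′) z → RuleValue σ (corner r) (corner r′) z
          shifted r r′ = RuleValue-shift σ w (cell x (v ⊕ r)) (cell x (v ⊕ r′))

    -- The potential of a configuration

    private
      ∈₀₀ : (0ℤ , 0ℤ) ∈ unitSquare
      ∈₀₀ = here refl
      ∈₁₀ : (1ℤ , 0ℤ) ∈ unitSquare
      ∈₁₀ = there (here refl)
      ∈₀₁ : (0ℤ , 1ℤ) ∈ unitSquare
      ∈₀₁ = there (there (here refl))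
      ∈₁₁ : (1ℤ , 1ℤ) ∈ unitSquare
      ∈₁₁ = there (there (there (here refl)))

      rightStep : (1ℤ , 0ℤ) ∈ unitSteps
      rightStep = here refl
      upStep : (0ℤ , 1ℤ) ∈ unitSteps
      upStep = there (there (here refl))

      at₀₀ : ∀ a b → (a , b) ⊕ (0ℤ , 0ℤ) ≡ (a , b)
      at₀₀ a b = ⊕-identityʳ (a , b)
      at₁₀ : ∀ a b → (a , b) ⊕ (1ℤ , 0ℤ) ≡ (ℤ.suc a , b)
      at₁₀ a b = cong₂ _,_ (ℤₚ.+-comm a 1ℤ) (ℤₚ.+-identityʳ b)
      at₀₁ : ∀ a b → (a , b) ⊕ (0ℤ , 1ℤ) ≡ (a , ℤ.suc b)
      at₀₁ a b = cong₂ _,_ (ℤₚ.+-identityʳ a) (ℤₚ.+-comm b 1ℤ)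
      at₁₁ : ∀ a b → (a , b) ⊕ (1ℤ , 1ℤ) ≡ (ℤ.suc a , ℤ.suc b)
      at₁₁ a b = cong₂ _,_ (ℤₚ.+-comm a 1ℤ) (ℤₚ.+-comm b 1ℤ)

      respect : ∀ {u u′ v v′ z} → u ≡ u′ → v ≡ v′ → Value u v z → Value u′ v′ z
      respect refl refl = id

      module SquareAt (v : ℤ²) where
        translated : ∃[ P ] P ∈ Ps × P ~ square x v
        translated = proj₂ squares (square x v)
          (square-twoByTwo x v , x , x∈ , square-appearsIn x v)

        square~P : square x v ~ proj₁ translated
        square~P = ~-sym (proj₁ translated) (square x v) (proj₂ (proj₂ translated))

        open Square (proj₁ (proj₂ translated)) v (proj₁ square~P) (proj₂ square~P) public

      -- Later arguments use only that these vectors are rule values of their edges, so their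
      -- construction is kept opaque.
      abstract
        rightValue : ∀ a b → ∃ (Value (a , b) (ℤ.suc a , b))
        rightValue a b = map₂ (respect (at₀₀ a b) (at₁₀ a b))
          (SquareAt.value-defined (a , b) (0ℤ , 0ℤ) (1ℤ , 0ℤ) ∈₀₀ ∈₁₀ rightStep)

        upValue : ∀ a b → ∃ (Value (a , b) (a , ℤ.suc b))
        upValue a b = map₂ (respect (at₀₀ a b) (at₀₁ a b))
          (SquareAt.value-defined (a , b) (0ℤ , 0ℤ) (0ℤ , 1ℤ) ∈₀₀ ∈₀₁ upStep)

      right up : ℤ → ℤ → ℤ²
      right a b = proj₁ (rightValue a b)
      up a b = proj₁ (upValue a b)

      -- The values on the right and top edges were chosen in neighbouring windows, but
      -- `value-square` for the window at (a , b) accepts any rule values of its edges.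
      curl : ∀ a b → right a b ⊕ up (ℤ.suc a) b ≡ up a b ⊕ right a (ℤ.suc b)
      curl a b = SquareAt.value-square (a , b)
        (0ℤ , 0ℤ) (1ℤ , 0ℤ) (0ℤ , 1ℤ) (1ℤ , 1ℤ) ∈₀₀ ∈₁₀ ∈₀₁ ∈₁₁
        rightStep upStep upStep rightStep
        (respect (sym (at₀₀ a b)) (sym (at₁₀ a b)) (proj₂ (rightValue a b)))
        (respect (sym (at₁₀ a b)) (sym (at₁₁ a b)) (proj₂ (upValue (ℤ.suc a) b)))
        (respect (sym (at₀₀ a b)) (sym (at₀₁ a b)) (proj₂ (upValue a b)))
        (respect (sym (at₀₁ a b)) (sym (at₁₁ a b)) (proj₂ (rightValue a (ℤ.suc b))))

      -- Image vectors have two coordinates; each is an integer-valued field and is integrated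
      -- separately.
      module X = Potential (λ a b → proj₁ (right a b)) (λ a b → proj₁ (up a b))
      module Y = Potential (λ a b → proj₂ (right a b)) (λ a b → proj₂ (up a b))

    φ : ℤ² → ℤ²
    φ (a , b) = X.potential a b , Y.potential a b

    private
      φ-right : ∀ a b → φ (ℤ.suc a , b) ≡ φ (a , b) ⊕ right a b
      φ-right a b = cong₂ _,_ (X.potential-right (λ a b → cong proj₁ (curl a b)) a b)
                              (Y.potential-right (λ a b → cong proj₂ (curl a b)) a b)

      φ-up : ∀ a b → φ (a , ℤ.suc b) ≡ φ (a , b) ⊕ up a b
      φ-up a b = cong₂ _,_ (X.potential-up a b) (Y.potential-up a b)

      -- `φ` is built from chosen rule values; determinism, through `RuleValue-unique`, identifies
      -- `z` with the value chosen for the same edge.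
      forward : ∀ {u v z} → (v ⊖ u) ≡ (1ℤ , 0ℤ) ⊎ (v ⊖ u) ≡ (0ℤ , 1ℤ) →
                Value u v z → φ v ≡ φ u ⊕ z
      forward {u@(a , b)} {v} (inj₁ eq) val = forward-right
        (trans (sym (⊕-⊖-cancel u v)) (trans (cong (u ⊕_) eq) (at₁₀ a b))) val
        where
        forward-right : ∀ {v z} → v ≡ (ℤ.suc a , b) → Value u v z → φ v ≡ φ u ⊕ z
        forward-right refl val = trans (φ-right a b) (cong (φ u ⊕_)
          (RuleValue-unique σ (cell x u) (cell x (ℤ.suc a , b)) (proj₂ (rightValue a b)) val))
      forward {u@(a , b)} {v} (inj₂ eq) val = forward-up
        (trans (sym (⊕-⊖-cancel u v)) (trans (cong (u ⊕_) eq) (at₀₁ a b))) val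
        where
        forward-up : ∀ {v z} → v ≡ (a , ℤ.suc b) → Value u v z → φ v ≡ φ u ⊕ z
        forward-up refl val = trans (φ-up a b) (cong (φ u ⊕_)
          (RuleValue-unique σ (cell x u) (cell x (a , ℤ.suc b)) (proj₂ (upValue a b)) val))

      -- The reversed edge points right or up and carries `⊝ z`, so `forward` applies to it.
      backward : ∀ {u v z} → (u ⊖ v) ≡ (1ℤ , 0ℤ) ⊎ (u ⊖ v) ≡ (0ℤ , 1ℤ) →
                 Value u v z → φ v ≡ φ u ⊕ z
      backward {u} {v} {z} step val =
        ⊕-transpose (φ v) z (φ u) (sym (forward step (RuleValue-reverse σ (cell x u) (cell x v) val)))

    -- A pair of cells with a rule value is a unit step apart, so these four directions exhaust all
    -- rules.
    φ-step : ∀ {u v z} → Value u v z → φ v ≡ φ u ⊕ z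
    φ-step {u} {v} val with RuleValue-unit σ complete (cell x u) (cell x v) val
    ... | here eq = forward (inj₁ eq) val
    ... | there (here eq) = backward (inj₁ (trans (sym (⊝-⊖ v u)) (cong ⊝_ eq))) val
    ... | there (there (here eq)) = forward (inj₂ eq) val
    ... | there (there (there (here eq))) =
      backward (inj₂ (trans (sym (⊝-⊖ v u)) (cong ⊝_ eq))) val

    -- The steps telescope. The `All` hypothesis places the whole path, translated by `w`, on `x`,
    -- whether or not the squares it passes lie in the pattern.
    φ-path : ∀ w {c c′ γ z} → All (λ d → x (w ⊕ vec d) ≡ proj₂ d) γ →
             head γ ≡ just c → last γ ≡ just c′ → ω σ γ z →
             φ (w ⊕ vec c′) ≡ φ (w ⊕ vec c) ⊕ z
    φ-path w _ refl refl [-] = sym (⊕-identityʳ _)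
    -- Matching on the type equations turns `shift w c` and `shift w d` into cells of `x`, as
    -- `φ-step` requires.
    φ-path w {c} {c′} (refl ∷ typed@(refl ∷ _)) refl ends (_∷_ {d = d} {v = z} {w = z′} val vals) =
      begin
        φ (w ⊕ vec c′)                ≡⟨ φ-path w typed refl ends vals ⟩
        φ (w ⊕ vec d) ⊕ z′            ≡⟨ cong (_⊕ z′) (φ-step (RuleValue-shift σ w c d val)) ⟩
        (φ (w ⊕ vec c) ⊕ z) ⊕ z′      ≡⟨ ⊕-assoc (φ (w ⊕ vec c)) z z′ ⟩
        φ (w ⊕ vec c) ⊕ (z ⊕ z′)      ∎
      where open ≡-Reasoning

  squares-consistent⇒patt-consistent : ConsistentOn σ (_∈ Ps) → ConsistentOn σ (patt 𝒮)
  squares-consistent⇒patt-consistent consistent P (x , x∈ , w , app) _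
      {c} {c′} _ _ (path , inP) (path′ , inP′) val val′ =
    -- Either image vector, added to `φ` at the common start, yields `φ` at the common end.
    ⊕-cancelˡ (φ consistent x∈ (w ⊕ vec c)) (trans (sym (φ-ω path inP val)) (φ-ω path′ inP′ val′))
    where
    φ-ω : ∀ {γ z} → IsPath σ c c′ γ → All (_∈ cells P) γ → ω σ γ z →
          φ consistent x∈ (w ⊕ vec c′) ≡ φ consistent x∈ (w ⊕ vec c) ⊕ z
    φ-ω path inP = φ-path consistent x∈ w
      (All.map (λ d∈ → app (∈-map⁺ (shift w) d∈)) inP) (IsPath.starts path) (IsPath.ends path)

theorem4p2 : {ℓ : Level} {A : Set} {k : ℕ} → A ↔ Fin k →
    (𝒮 : Pred (Config A) ℓ) (Ps : List (Pattern A)) →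
    (_∈ Ps) ≈τ (TwoByTwo ∩ patt 𝒮) →
    (σ : Substitution A) → DominoComplete σ (_∈ Ps) →
    ConsistentOn σ (patt 𝒮) ⇔ ConsistentOn σ (_∈ Ps)
theorem4p2 _ 𝒮 Ps squares σ complete =
  mk⇔ (patt-consistent⇒squares-consistent squares σ complete)
      (squares-consistent⇒patt-consistent squares σ complete)
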